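{- Let $k \geq 2$ be an integer and let $\{F_n(k)\}_{n \geq 0}$ be any sequence of integers satisfying $F_n(k) = F_{n-1}(k) + F_{n-2}(k) + \dots + F_{n-k}(k)$ for all $n \geq k$. Let $n=a(k+1) + r$ with integers $a \geq 1$ and $-1 \leq r \leq k-1$. (i) If $r=-1$ and $v_2(F_k(k))=0$, then $v_2(F_n(k))=0$. (ii) If $r \geq 0$ and $v_2\left( \sum_{j=0}^{r} F_j(k) \binom{a+r-j-1}{a-1} 2^{r-j} \right) \leq r$, then $$v_2(F_n(k))= v_2 \left( \sum_{j=0}^{r} F_j(k) \binom{a+r-j-1}{a-1} 2^{r-j} \right).$$
   Context: $v_2$ denotes the 2-adic order (2-adic valuation) on the integers, with the convention $v_2(0)=+\infty$. -}

module Defs where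

open import Data.Integer.Base as ℤ using (ℤ; +_; -[1+_]; ∣_∣)
import Data.Integer.Properties as ℤ
open import Data.Fin.Base using (toℕ)
open import Data.Nat.Base
open import Data.Nat.Combinatorics using (_C_)
open import Data.Nat.Divisibility
open import Data.Nat.Properties
open import Relation.Binary.PropositionalEquality
open import Relation.Nullary using (yes; no)
open import Relation.Nullary.Construct.Add.Supremum public using (_⁺; [_]; ⊤⁺)
open import Relation.Binary.Construct.Add.Supremum.NonStrict _≤_ public
  using (_≤⁺_)
open import Algebra.Properties.CommutativeMonoid.Sum ℤ.+-0-commutativeMonoid
  using (sum-syntax; sum⁺-syntax)

-- The largest e ≤ b with 2 ^ e ∣ m.
maxExp : (m b : ℕ) → ℕ
maxExp m zero    = 0
maxExp m (suc b) with 2 ^ suc b ∣? m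
... | yes _ = suc b
... | no  _ = maxExp m b

-- For m ≠ 0, 2 ^ e ∣ m forces e < 2 ^ e ≤ m, so the bound m is harmless;
-- v₂-divides and v₂-maximal confirm this.
v₂ : ℤ → ℕ ⁺
v₂ (+ zero)  = ⊤⁺
v₂ (+ suc m) = [ maxExp (suc m) (suc m) ]
v₂ -[1+ m ]  = [ maxExp (suc m) (suc m) ]

KStepRecurrence : ℕ → (ℕ → ℤ) → Set
KStepRecurrence k F =
  ∀ n → k ≤ n → F n ≡ ∑[ i < k ] F (n ∸ suc (toℕ i))

-- For 1 ≤ a none of the truncated subtractions truncates.
binomialSum : (ℕ → ℤ) → (a r : ℕ) → ℤ
binomialSum F a r =
  ∑[ j ≤ r ] (F (toℕ j)
    ℤ.* + ((a + r ∸ toℕ j ∸ 1) C (a ∸ 1))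
    ℤ.* + (2 ^ (r ∸ toℕ j)))

maxExp-divides : ∀ m b → 2 ^ maxExp m b ∣ m
maxExp-divides m zero    = 1∣ m
maxExp-divides m (suc b) with 2 ^ suc b ∣? m
... | yes p = p
... | no  _ = maxExp-divides m b

maxExp-maximal : ∀ m b {f} → f ≤ b → 2 ^ f ∣ m → f ≤ maxExp m b
maxExp-maximal m zero    f≤0 _ = f≤0
maxExp-maximal m (suc b) {f} f≤1+b d with 2 ^ suc b ∣? m
... | yes _ = f≤1+b
... | no ¬p = maxExp-maximal m b
  (s≤s⁻¹ (≤∧≢⇒< f≤1+b λ f≡1+b → ¬p (subst (λ e → 2 ^ e ∣ m) f≡1+b d))) d

n<2^n : ∀ n → n < 2 ^ n
n<2^n zero    = z<s
n<2^n (suc n) = begin-strict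
  suc n          ≤⟨ n<2^n n ⟩
  2 ^ n          <⟨ m<m+n (2 ^ n) (m^n>0 2 n) ⟩
  2 ^ n + 2 ^ n  ≡⟨ cong (_+_ (2 ^ n)) (sym (+-identityʳ (2 ^ n))) ⟩
  2 ^ suc n      ∎
  where open ≤-Reasoning

v₂-divides : ∀ x {e} → v₂ x ≡ [ e ] → 2 ^ e ∣ ∣ x ∣
v₂-divides (+ suc m) refl = maxExp-divides (suc m) (suc m)
v₂-divides -[1+ m ]  refl = maxExp-divides (suc m) (suc m)

v₂-maximal : ∀ x {e} → v₂ x ≡ [ e ] → ∀ {f} → 2 ^ f ∣ ∣ x ∣ → f ≤ e
v₂-maximal (+ suc m) refl {f} d = maxExp-maximal (suc m) (suc m)
  (≤-trans (<⇒≤ (n<2^n f)) (∣⇒≤ d)) d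
v₂-maximal -[1+ m ]  refl {f} d = maxExp-maximal (suc m) (suc m)
  (≤-trans (<⇒≤ (n<2^n f)) (∣⇒≤ d)) d

{-# OPTIONS --safe #-}
-- With m = k + 1, subtracting consecutive instances of the recurrence gives
-- F (n + m) = 2 F (n + m - 1) - F n.  Write S a r for the sum in (ii).  As the
-- coefficient of x^r in F(x) / (1 - 2x)^a it satisfies
-- S (a + 1) (r + 1) = 2 S (a + 1) r + S a (r + 1), so (-1)^a S a r obeys the
-- same rule as F (r + a m), and induction gives
-- F (r + a m) ≡ (-1)^a S a r mod 2^(r + 1).  A congruence mod 2^(r + 1)
-- determines every 2-adic order that is at most r.
module Submission where

open import Defs
open import Algebra.Properties.CommutativeMonoid.Sum
  using (sum-cong-≗; sum-init-last)
open import Data.Empty using (⊥-elim)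
open import Data.Fin.Base using (toℕ)
open import Data.Fin.Properties using (toℕ-inject₁; toℕ-fromℕ; toℕ≤pred[n])
open import Data.Integer.Base as ℤ using (ℤ; +_; -1ℤ; 1ℤ; 0ℤ; -[1+_]; ∣_∣)
import Data.Integer.Properties as ℤ
open import Data.Integer.Divisibility.Signed as ℤ using (∣ᵤ⇒∣; ∣⇒∣ᵤ)
open import Data.Integer.Tactic.RingSolver using (solve-∀)
open import Data.Nat.Base
  using (ℕ; zero; suc; _+_; _*_; _∸_; _^_; _≤_; s≤s; z≤n)
open import Data.Nat.Combinatorics using (_C_; nCn≡1; nCk+nC[k+1]≡[n+1]C[k+1])
open import Data.Nat.Divisibility using (_∣_; _∣0; ∣-trans; m∣m*n)
import Data.Nat.Properties as ℕ
open import Algebra.Properties.CommutativeSemigroup ℕ.+-commutativeSemigroup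
  using (x∙yz≈y∙xz)
open import Data.Product.Base using (_×_; _,_)
open import Relation.Binary.Construct.Add.Supremum.NonStrict _≤_ using ([_])
open import Relation.Binary.PropositionalEquality
  using (_≡_; refl; sym; trans; cong; cong₂; subst; module ≡-Reasoning)
open import Relation.Nullary using (¬_)

open Algebra.Properties.CommutativeMonoid.Sum ℤ.+-0-commutativeMonoid
  using (sum-syntax; sum⁺-syntax)

-- 2-adic orders under congruence and negation.

2^-mono-∣ : ∀ {m n} → m ≤ n → 2 ^ m ∣ 2 ^ n
2^-mono-∣ {m} {n} m≤n = subst (2 ^ m ∣_)
  (trans (sym (ℕ.^-distribˡ-+-* 2 m (n ∸ m))) (cong (2 ^_) (ℕ.m+[n∸m]≡n m≤n)))
  (m∣m*n (2 ^ (n ∸ m)))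

v₂-unique : ∀ x {e} → 2 ^ e ∣ ∣ x ∣ → ¬ (2 ^ suc e ∣ ∣ x ∣) → v₂ x ≡ [ e ]
v₂-unique (+ zero) {e} _ ∤x = ⊥-elim (∤x ((2 ^ suc e) ∣0))
v₂-unique x@(+ suc _) {e} ∣x ∤x = cong [_] (ℕ.≤-antisym
  (ℕ.≮⇒≥ λ e< → ∤x (∣-trans (2^-mono-∣ e<) (v₂-divides x refl)))
  (v₂-maximal x refl ∣x))
v₂-unique x@(-[1+ _ ]) {e} ∣x ∤x = cong [_] (ℕ.≤-antisym
  (ℕ.≮⇒≥ λ e< → ∤x (∣-trans (2^-mono-∣ e<) (v₂-divides x refl)))
  (v₂-maximal x refl ∣x))

v₂-neg : ∀ x → v₂ (ℤ.- x) ≡ v₂ x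
v₂-neg (+ zero)  = refl
v₂-neg (+ suc _) = refl
v₂-neg -[1+ _ ]  = refl

x-[x-y]≡y : ∀ x y → x ℤ.- (x ℤ.- y) ≡ y
x-[x-y]≡y = solve-∀

[x-y]+y≡x : ∀ x y → (x ℤ.- y) ℤ.+ y ≡ x
[x-y]+y≡x = solve-∀

-- For exponents up to `s + 1`, a power of 2 divides `x` iff it divides `y`. If `v₂ y` is `[ e ]`,
-- the bound puts both `e` and `e + 1` in that range, and these two exponents fix the order. The
-- bound also rules out `⊤⁺`, so no clause treats it.
v₂-cong : ∀ {x y s} → + (2 ^ suc s) ℤ.∣ x ℤ.- y → v₂ y ≤⁺ [ s ] → v₂ x ≡ v₂ y
v₂-cong {x} {y} {s} x≡y v₂y≤s with v₂ y in v₂y≡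
v₂-cong {x} {y} {s} x≡y [ e≤s ] | [ e ] =
  v₂-unique x
    (y→x (ℕ.m≤n⇒m≤1+n e≤s) (v₂-divides y v₂y≡))
    (λ ∣x → ℕ.1+n≰n (v₂-maximal y v₂y≡ (x→y (s≤s e≤s) ∣x)))
  where
  ∣x-y : ∀ {f} → f ≤ suc s → + (2 ^ f) ℤ.∣ x ℤ.- y
  ∣x-y f≤ = ℤ.∣-trans (∣ᵤ⇒∣ (2^-mono-∣ f≤)) x≡y

  y→x : ∀ {f} → f ≤ suc s → 2 ^ f ∣ ∣ y ∣ → 2 ^ f ∣ ∣ x ∣
  y→x f≤ ∣y = ∣⇒∣ᵤ (subst (_ ℤ.∣_) ([x-y]+y≡x x y)
    (ℤ.∣m∣n⇒∣m+n (∣x-y f≤) (∣ᵤ⇒∣ ∣y)))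

  x→y : ∀ {f} → f ≤ suc s → 2 ^ f ∣ ∣ x ∣ → 2 ^ f ∣ ∣ y ∣
  x→y f≤ ∣x = ∣⇒∣ᵤ (subst (_ ℤ.∣_) (x-[x-y]≡y x y)
    (ℤ.∣m∣n⇒∣m-n {m = x} (∣ᵤ⇒∣ ∣x) (∣x-y f≤)))

-- Convolutions and the coefficients of 1 / (1 - 2x)^a.

-- The coefficient of x^r in the product of the generating functions of `F` and `w`. Splitting off j
-- = 0 leaves, definitionally, `conv` of the shifted sequence, so the inductions below let `F` vary.
conv : (F w : ℕ → ℤ) → ℕ → ℤ
conv F w r = ∑[ j ≤ r ] (F (toℕ j) ℤ.* w (r ∸ toℕ j))

module _ (u v : ℕ → ℤ) (u₀≡v₀ : u 0 ≡ v 0)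
         (u-suc : ∀ d → u (suc d) ≡ + 2 ℤ.* u d ℤ.+ v (suc d)) where

  conv-zero : ∀ F → conv F u 0 ≡ conv F v 0
  conv-zero F = cong (λ z → F 0 ℤ.* z ℤ.+ 0ℤ) u₀≡v₀

  -- For generating functions the hypotheses say U = 2xU + V, and multiplying by that of `F` keeps
  -- this shape. The induction uses `u-suc` on every term but the last, whose weight has index 0 and
  -- needs `u₀≡v₀`.
  conv-suc : ∀ F r →
    conv F u (suc r) ≡ + 2 ℤ.* conv F u r ℤ.+ conv F v (suc r)
  conv-suc F zero = trans
    (cong₂ (λ p q → F 0 ℤ.* p ℤ.+ q) (u-suc 0) (conv-zero (λ i → F (suc i))))
    (rearrange (F 0) (u 0) (v 1) _)
    where
    rearrange : ∀ f u₀ v₁ c →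
      f ℤ.* (+ 2 ℤ.* u₀ ℤ.+ v₁) ℤ.+ c
        ≡ + 2 ℤ.* (f ℤ.* u₀ ℤ.+ 0ℤ) ℤ.+ (f ℤ.* v₁ ℤ.+ c)
    rearrange = solve-∀
  conv-suc F (suc r) = trans
    (cong₂ (λ p q → F 0 ℤ.* p ℤ.+ q)
      (u-suc (suc r)) (conv-suc (λ i → F (suc i)) r))
    (rearrange (F 0) (u (suc r)) (v (suc (suc r))) _ _)
    where
    rearrange : ∀ f p q c d →
      f ℤ.* (+ 2 ℤ.* p ℤ.+ q) ℤ.+ (+ 2 ℤ.* c ℤ.+ d)
        ≡ + 2 ℤ.* (f ℤ.* p ℤ.+ c) ℤ.+ (f ℤ.* q ℤ.+ d)
    rearrange = solve-∀

-- weight a d is the coefficient of x^d in 1 / (1 - 2x)^a.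
weight : ℕ → ℕ → ℤ
weight zero    zero    = 1ℤ
weight zero    (suc _) = 0ℤ
weight (suc b) d       = + ((b + d) C b) ℤ.* + (2 ^ d)

weight-zero : ∀ a → weight (suc a) 0 ≡ weight a 0
weight-zero zero    = refl
weight-zero (suc b) = cong (λ c → + c ℤ.* 1ℤ)
  (trans (nC0 (suc b)) (sym (nC0 b)))
  where
  nC0 : ∀ n → (n + 0) C n ≡ 1
  nC0 n = trans (cong (_C n) (ℕ.+-identityʳ n)) (nCn≡1 n)

-- Multiplying 1 / (1 - 2x)^(a+1) by 1 - 2x lowers the exponent by one. On coefficients this is the
-- doubling of 2^d when a = 0 and Pascal's rule otherwise.
weight-suc : ∀ a d →
  weight (suc a) (suc d) ≡ + 2 ℤ.* weight (suc a) d ℤ.+ weight a (suc d)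
weight-suc zero d = trans
  (cong (1ℤ ℤ.*_) (ℤ.pos-* 2 (2 ^ d)))
  (rearrange (+ (2 ^ d)))
  where
  rearrange : ∀ p → 1ℤ ℤ.* (+ 2 ℤ.* p) ≡ + 2 ℤ.* (1ℤ ℤ.* p) ℤ.+ 0ℤ
  rearrange = solve-∀
weight-suc (suc b) d = begin
  + ((suc b + suc d) C suc b) ℤ.* + (2 ^ suc d)
    ≡⟨ cong₂ ℤ._*_ pascal (ℤ.pos-* 2 (2 ^ d)) ⟩
  (+ ((b + suc d) C b) ℤ.+ + ((suc b + d) C suc b)) ℤ.* (+ 2 ℤ.* + (2 ^ d))
    ≡⟨ rearrange (+ ((b + suc d) C b)) (+ ((suc b + d) C suc b)) (+ (2 ^ d)) ⟩
  + 2 ℤ.* weight (suc (suc b)) d ℤ.+ + ((b + suc d) C b) ℤ.* (+ 2 ℤ.* + (2 ^ d))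
    ≡⟨ cong (λ p → + 2 ℤ.* weight (suc (suc b)) d ℤ.+ + ((b + suc d) C b) ℤ.* p)
         (ℤ.pos-* 2 (2 ^ d)) ⟨
  + 2 ℤ.* weight (suc (suc b)) d ℤ.+ weight (suc b) (suc d) ∎
  where
  open ≡-Reasoning
  pascal : + ((suc b + suc d) C suc b)
             ≡ + ((b + suc d) C b) ℤ.+ + ((suc b + d) C suc b)
  pascal = begin
    + (suc (b + suc d) C suc b)
      ≡⟨ cong +_ (nCk+nC[k+1]≡[n+1]C[k+1] (b + suc d) b) ⟨
    + ((b + suc d) C b + (b + suc d) C suc b)
      ≡⟨ cong (λ n → + ((b + suc d) C b + n C suc b)) (ℕ.+-suc b d) ⟩
    + ((b + suc d) C b + (suc b + d) C suc b)
      ≡⟨ ℤ.pos-+ ((b + suc d) C b) ((suc b + d) C suc b) ⟩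
    + ((b + suc d) C b) ℤ.+ + ((suc b + d) C suc b) ∎

  rearrange : ∀ x y p →
    (x ℤ.+ y) ℤ.* (+ 2 ℤ.* p) ≡ + 2 ℤ.* (y ℤ.* p) ℤ.+ x ℤ.* (+ 2 ℤ.* p)
  rearrange = solve-∀

conv-weight-zero : ∀ F r → conv F (weight 0) r ≡ F r
conv-weight-zero F zero = trans (ℤ.+-identityʳ _) (ℤ.*-identityʳ (F 0))
conv-weight-zero F (suc r) = begin
  F 0 ℤ.* 0ℤ ℤ.+ conv (λ i → F (suc i)) (weight 0) r
    ≡⟨ cong₂ ℤ._+_ (ℤ.*-zeroʳ (F 0)) (conv-weight-zero (λ i → F (suc i)) r) ⟩
  0ℤ ℤ.+ F (suc r)
    ≡⟨ ℤ.+-identityˡ (F (suc r)) ⟩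
  F (suc r) ∎
  where open ≡-Reasoning

binomialSum≡conv : ∀ F b r → binomialSum F (suc b) r ≡ conv F (weight (suc b)) r
binomialSum≡conv F b r = sum-cong-≗ ℤ.+-0-commutativeMonoid λ j → trans
  (ℤ.*-assoc (F (toℕ j))
    (+ ((suc b + r ∸ toℕ j ∸ 1) C b)) (+ (2 ^ (r ∸ toℕ j))))
  (cong (λ n → F (toℕ j) ℤ.* (+ (n C b) ℤ.* + (2 ^ (r ∸ toℕ j))))
    -- Since j ≤ r, the difference `r ∸ toℕ j` can be formed first; the outer `∸ 1` then cancels the
    -- successor in `suc b` definitionally.
    (cong (_∸ 1) (ℕ.+-∸-assoc (suc b) (toℕ≤pred[n] j))))

-- This is (-1)^a. As iterated negation, `sign (suc a)` reduces to `ℤ.- sign a`, which matches the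
-- minus sign in `F-step`.
sign : ℕ → ℤ
sign zero    = 1ℤ
sign (suc a) = ℤ.- sign a

v₂-sign* : ∀ a x → v₂ (sign a ℤ.* x) ≡ v₂ x
v₂-sign* zero    x = cong v₂ (ℤ.*-identityˡ x)
v₂-sign* (suc a) x = begin
  v₂ (ℤ.- sign a ℤ.* x)    ≡⟨ cong v₂ (ℤ.neg-distribˡ-* (sign a) x) ⟨
  v₂ (ℤ.- (sign a ℤ.* x))  ≡⟨ v₂-neg (sign a ℤ.* x) ⟩
  v₂ (sign a ℤ.* x)        ≡⟨ v₂-sign* a x ⟩
  v₂ x                     ∎
  where open ≡-Reasoning

double∣ : ∀ {d x} → + d ℤ.∣ x → + (2 * d) ℤ.∣ + 2 ℤ.* x
double∣ {d} {x} ∣x =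
  subst (ℤ._∣ + 2 ℤ.* x) (sym (ℤ.pos-* 2 d)) (ℤ.*-monoʳ-∣ (+ 2) ∣x)

2∣2* : ∀ x → + 2 ℤ.∣ + 2 ℤ.* x
2∣2* x = ℤ.∣m⇒∣m*n x ℤ.∣-refl

-- The recurrence modulo powers of 2.

module _ {k′ : ℕ} (F : ℕ → ℤ) (F-rec : KStepRecurrence (suc k′) F) where

  private
    k = suc k′

  -- The windows of `k` terms for `F (suc k + i)` and `F (k + i)` share `k′` terms, with sum t. The
  -- first window adds `F (k + i)` to t, the second adds `F i`; eliminating t gives the claim.
  F-step : ∀ i → F (suc k + i) ≡ + 2 ℤ.* F (k + i) ℤ.- F i
  F-step i = trans (F-rec (suc (k + i)) (ℕ.m≤n⇒m≤1+n (ℕ.m≤m+n k i)))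
    (solve-for (F (k + i)) _ (F i) (trans (F-rec (k + i) (ℕ.m≤m+n k i)) tail-sum))
    where
    solve-for : ∀ x t y → x ≡ t ℤ.+ y → x ℤ.+ t ≡ + 2 ℤ.* x ℤ.- y
    -- Matching on `refl` replaces x by t + y, which leaves a pure ring identity.
    solve-for _ t y refl = identity t y
      where
      identity : ∀ t y → (t ℤ.+ y) ℤ.+ t ≡ + 2 ℤ.* (t ℤ.+ y) ℤ.- y
      identity = solve-∀

    tail-sum : ∑[ j < k ] F (k + i ∸ suc (toℕ j))
                 ≡ ∑[ j < k′ ] F (k + i ∸ suc (toℕ j)) ℤ.+ F i
    tail-sum = trans
      (sum-init-last ℤ.+-0-commutativeMonoid {k′} (λ j → F (k + i ∸ suc (toℕ {k} j))))
      (cong₂ ℤ._+_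
        (sum-cong-≗ ℤ.+-0-commutativeMonoid {k′}
          (λ j → cong (λ n → F (k + i ∸ suc n)) (toℕ-inject₁ j)))
        (cong F (trans (cong (λ n → k + i ∸ suc n) (toℕ-fromℕ k′))
                       (ℕ.m+n∸m≡n k i))))

  -- This is `F-step` in the coordinates (r, a) of the index r + a(k+1): the two earlier terms lie
  -- one step down in r and one step down in a.
  F-step′ : ∀ r a →
    F (suc r + suc a * suc k) ≡ + 2 ℤ.* F (r + suc a * suc k) ℤ.- F (suc r + a * suc k)
  F-step′ r a = begin
    F (suc r + (suc k + a * suc k))
      ≡⟨ cong F (swap (suc r)) ⟩
    F (suc k + (suc r + a * suc k))
      ≡⟨ F-step (suc r + a * suc k) ⟩
    + 2 ℤ.* F (k + suc (r + a * suc k)) ℤ.- F (suc r + a * suc k)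
      ≡⟨ cong (λ n → + 2 ℤ.* F n ℤ.- F (suc r + a * suc k))
           (trans (ℕ.+-suc k _) (sym (swap r))) ⟩
    + 2 ℤ.* F (r + suc a * suc k) ℤ.- F (suc r + a * suc k) ∎
    where
    open ≡-Reasoning
    swap : ∀ r → r + (suc k + a * suc k) ≡ suc k + (r + a * suc k)
    swap r = x∙yz≈y∙xz r (suc k) (a * suc k)

  -- The error at (a+1, r+1) is twice the error at (a+1, r) minus the error at (a, r+1). The
  -- doubling supplies the extra factor 2 that the modulus 2^(r+2) demands. At a = 0 the error
  -- vanishes.
  F-mod-2^ : ∀ a r →
    + (2 ^ suc r) ℤ.∣ F (r + a * suc k) ℤ.- sign a ℤ.* conv F (weight a) r
  F-mod-2^ zero r = subst (_ ℤ.∣_) (sym difference≡0) (∣ᵤ⇒∣ ((2 ^ suc r) ∣0))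
    where
    difference≡0 : F (r + 0) ℤ.- 1ℤ ℤ.* conv F (weight 0) r ≡ 0ℤ
    difference≡0 = trans
      (cong₂ ℤ._-_ (cong F (ℕ.+-identityʳ r))
        (trans (ℤ.*-identityˡ (conv F (weight 0) r)) (conv-weight-zero F r)))
      (ℤ.+-inverseʳ (F r))
  -- The term just before index (a+1)(k+1) is `F (k + a * suc k)`. It enters doubled, so it vanishes
  -- modulo 2, which is the whole modulus at r = 0.
  F-mod-2^ (suc a) zero = subst (_ ℤ.∣_) (sym difference≡)
    (ℤ.∣m∣n⇒∣m-n {m = + 2 ℤ.* F (k + a * suc k)}
      (2∣2* (F (k + a * suc k))) (F-mod-2^ a 0))
    where
    rearrange : ∀ x y e c →
      (+ 2 ℤ.* x ℤ.- y) ℤ.- ℤ.- e ℤ.* c ≡ + 2 ℤ.* x ℤ.- (y ℤ.- e ℤ.* c)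
    rearrange = solve-∀

    difference≡ :
      F (suc k + a * suc k) ℤ.- sign (suc a) ℤ.* conv F (weight (suc a)) 0
        ≡ + 2 ℤ.* F (k + a * suc k) ℤ.- (F (a * suc k) ℤ.- sign a ℤ.* conv F (weight a) 0)
    difference≡ = trans
      (cong₂ (λ f c → f ℤ.- sign (suc a) ℤ.* c)
        (F-step (a * suc k))
        (conv-zero (weight (suc a)) (weight a) (weight-zero a) (weight-suc a) F))
      (rearrange (F (k + a * suc k)) (F (a * suc k)) (sign a)
        (conv F (weight a) 0))
  F-mod-2^ (suc a) (suc r) = subst (_ ℤ.∣_) (sym difference≡)
    (ℤ.∣m∣n⇒∣m-n
      {m = + 2 ℤ.* (F (r + suc a * suc k) ℤ.- sign (suc a) ℤ.* conv F (weight (suc a)) r)}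
      (double∣ (F-mod-2^ (suc a) r)) (F-mod-2^ a (suc r)))
    where
    rearrange : ∀ x y e c d →
      (+ 2 ℤ.* x ℤ.- y) ℤ.- ℤ.- e ℤ.* (+ 2 ℤ.* c ℤ.+ d)
        ≡ + 2 ℤ.* (x ℤ.- ℤ.- e ℤ.* c) ℤ.- (y ℤ.- e ℤ.* d)
    rearrange = solve-∀

    difference≡ :
      F (suc r + suc a * suc k) ℤ.- sign (suc a) ℤ.* conv F (weight (suc a)) (suc r)
        ≡ + 2 ℤ.* (F (r + suc a * suc k) ℤ.- sign (suc a) ℤ.* conv F (weight (suc a)) r)
          ℤ.- (F (suc r + a * suc k) ℤ.- sign a ℤ.* conv F (weight a) (suc r))
    difference≡ = trans
      (cong₂ (λ f c → f ℤ.- sign (suc a) ℤ.* c)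
        (F-step′ r a)
        (conv-suc (weight (suc a)) (weight a) (weight-zero a) (weight-suc a) F r))
      (rearrange (F (r + suc a * suc k)) (F (suc r + a * suc k)) (sign a)
        (conv F (weight (suc a)) r) (conv F (weight a) (suc r)))

  -- Modulo 2 the rule `F-step` makes `F` periodic with period k + 1. This serves r = -1, because
  -- a(k+1) - 1 = k + (a-1)(k+1).
  F-mod-2 : ∀ a → + 2 ℤ.∣ F (k + a * suc k) ℤ.- F k
  F-mod-2 zero = subst (_ ℤ.∣_)
    (sym (trans (cong (λ n → F n ℤ.- F k) (ℕ.+-identityʳ k)) (ℤ.+-inverseʳ (F k))))
    (∣ᵤ⇒∣ (2 ∣0))
  F-mod-2 (suc a) = subst (_ ℤ.∣_) (sym difference≡)
    (ℤ.∣m∣n⇒∣m+n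
      {m = + 2 ℤ.* (F (k′ + suc a * suc k) ℤ.- F (k + a * suc k))}
      (2∣2* (F (k′ + suc a * suc k) ℤ.- F (k + a * suc k))) (F-mod-2 a))
    where
    rearrange : ∀ x y z →
      (+ 2 ℤ.* x ℤ.- y) ℤ.- z ≡ + 2 ℤ.* (x ℤ.- y) ℤ.+ (y ℤ.- z)
    rearrange = solve-∀

    difference≡ :
      F (k + suc a * suc k) ℤ.- F k
        ≡ + 2 ℤ.* (F (k′ + suc a * suc k) ℤ.- F (k + a * suc k))
          ℤ.+ (F (k + a * suc k) ℤ.- F k)
    difference≡ = trans
      (cong (ℤ._- F k) (F-step′ k′ a))
      (rearrange (F (k′ + suc a * suc k)) (F (k + a * suc k)) (F k))

theorem9 : ∀ (k : ℕ) → 2 ≤ k →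
    ∀ (F : ℕ → ℤ) → KStepRecurrence k F →
    ∀ (n a : ℕ) (r : ℤ) → 1 ≤ a → -1ℤ ℤ.≤ r → r ℤ.≤ + k ℤ.- 1ℤ →
    + n ≡ + a ℤ.* + suc k ℤ.+ r →
    (r ≡ -1ℤ → v₂ (F k) ≡ [ 0 ] → v₂ (F n) ≡ [ 0 ])
    ×
    (∀ (s : ℕ) → r ≡ + s →
    v₂ (binomialSum F a s) ≤⁺ [ s ] →
    v₂ (F n) ≡ v₂ (binomialSum F a s))
theorem9 k@(suc _) _ F F-rec n a@(suc a′) _ _ _ _ n≡ = part-i , part-ii
  where
  part-i : _ ≡ -1ℤ → v₂ (F k) ≡ [ 0 ] → v₂ (F n) ≡ [ 0 ]
  part-i refl v₂≡0 = trans
    (v₂-cong {s = 0}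
      -- At r = -1 the right side of `n≡` computes to `+ (k + a′ * suc k)`.
      (subst (λ i → + 2 ℤ.∣ F i ℤ.- F k) (sym (ℤ.+-injective n≡)) (F-mod-2 F F-rec a′))
      (subst (_≤⁺ [ 0 ]) (sym v₂≡0) [ z≤n ]))
    v₂≡0

  part-ii : ∀ s → _ ≡ + s → v₂ (binomialSum F a s) ≤⁺ [ s ] →
            v₂ (F n) ≡ v₂ (binomialSum F a s)
  -- The congruence concerns the sum times `sign a`, so `signed` is used twice: to move the bound
  -- onto the product and to remove the sign from the result.
  part-ii s refl v₂≤s = trans
    (v₂-cong F-mod (subst (_≤⁺ [ s ]) (sym signed) v₂≤s)) signed
    where
    signed : v₂ (sign a ℤ.* binomialSum F a s) ≡ v₂ (binomialSum F a s)
    signed = v₂-sign* a (binomialSum F a s)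

    n≡s+am : n ≡ s + a * suc k
    n≡s+am = trans (ℤ.+-injective n≡) (ℕ.+-comm (a * suc k) s)

    F-mod : + (2 ^ suc s) ℤ.∣ F n ℤ.- sign a ℤ.* binomialSum F a s
    F-mod = subst (_ ℤ.∣_)
      (sym (cong₂ (λ i c → F i ℤ.- sign a ℤ.* c) n≡s+am (binomialSum≡conv F a′ s)))
      (F-mod-2^ F F-rec a s)
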